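{- Let $H=\prod_p p^{a_p}<H'=\prod_p p^{b_p}$ be consecutive highly composite numbers. Suppose exactly one source support prime disappears: for some prime $r$ one has $a_r=1$, $b_r=0$, and no prime $p\ne r$ satisfies $a_p>0=b_p$. Delete the layer $(r,1)$ first. List all remaining required deletion layers as $D_i=(p_i,A_i)$, $1\le i\le k$ (where $D_i$ lowers the exponent of $p_i$ from $A_i$ to $A_i-1$), in a stack-admissible order, i.e. if $p_i=p_h$ and $i<h$ then $A_i>A_h$. Match them injectively to distinct required insertion layers $I_i=(q_i,j_i)$, $1\le i\le k$ (where $I_i$ raises the exponent of $q_i$ from $j_i-1$ to $j_i$). Set $x_0=H/r$. For $i=1,\dots,k$ put $e_i=v_{q_i}(x_{i-1})$, require $e_i<j_i$, insert successively the still missing prerequisite layers $(q_i,e_i+1),\dots,(q_i,j_i-1)$ followed by $I_i=(q_i,j_i)$, reaching the state $y_i=x_{i-1}q_i^{\,j_i-e_i}$; then execute $D_i$ and put $x_i=y_i/p_i$. Suppose that for every $i$: (a) none of the prerequisite layers $(q_i,e_i+1),\dots,(q_i,j_i-1)$ is one of the later matched layers $I_{i+1},\dots,I_k$; (b) $y_i\le H$; (c) $j_i\le A_i$. After stage $k$, execute all remaining required insertion layers in any stack-admissible order. Then this schedule is an $H'$-admissible geodesic from $H$ to $H'$, and $$\beta^{\mathrm{geo}}(H,H')=\frac12.$$ Moreover, if $q_i>p_i$ for some $i$, then condition (c) for that $i$ holds automatically.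
   Context: $d(n)$ denotes the number of positive divisors of $n$, and $v_q(x)$ the exponent of the prime $q$ in $x$. A positive integer $H$ is highly composite if $d(m)<d(H)$ for all integers $1\le m<H$. Two highly composite numbers $H<H'$ are consecutive if no highly composite number lies strictly between them. A required deletion layer is a pair $(p,j)$ with $p$ prime and $b_p<j\le a_p$, standing for the move lowering the exponent of $p$ from $j$ to $j-1$; a required insertion layer is a pair $(p,j)$ with $a_p<j\le b_p$, standing for the move raising the exponent of $p$ from $j-1$ to $j$. An order of insertion layers is stack-admissible if in each prime coordinate the levels $j$ are inserted in increasing order. An exponent-lattice geodesic from $H$ to $H'$ is a sequence of positive integers starting at $H$ and ending at $H'$ in which each step changes the exponent of exactly one prime by one unit, always in the direction of its target exponent. It is $H'$-admissible if every vertex $z$ satisfies $z\le H'$. The normalised geodesic capacity is $$\beta^{\mathrm{geo}}(H,H')=\frac{1}{d(H)}\max_{\gamma}\min_{z\in\gamma}d(z),$$ where $\gamma$ ranges over the $H'$-admissible geodesics from $H$ to $H'$ and $z$ over all vertices of $\gamma$, endpoints included. -}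

module Defs where

open import Data.Fin.Base using (Fin; zero; suc; inject₁)
import Data.Fin.Base as Fin
open import Data.Integer.Base using (+_)
open import Data.List.Base using (List; []; _∷_; [_]; _++_; map; filter; length; upTo; applyUpTo; concat; tabulate)
open import Data.List.Extrema.Nat using (max)
open import Data.List.Membership.Propositional using (_∈_; _∉_)
open import Data.List.NonEmpty.Base using (List⁺; head; last; toList; foldr₁)
import Data.List.NonEmpty.Base as List⁺
open import Data.List.Properties using (filter-accept)
open import Data.List.Relation.Unary.All using (All)
open import Data.List.Relation.Unary.AllPairs using (AllPairs)
open import Data.List.Relation.Unary.Linked using (Linked)
open import Data.List.Scans.Base using (scanl⁺)
open import Data.Nat.Base using (ℕ; zero; suc; _+_; _*_; _^_; _∸_; _/_; _⊓_; _≤_; _<_; NonZero)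
open import Data.Nat.Divisibility using (_∣?_; 1∣_)
open import Data.Nat.Primality using (Prime)
open import Data.Nat.Properties using (≤-antisym)
open import Data.Product.Base using (_×_; _,_; ∃-syntax)
open import Data.Rational.Base using (ℚ) renaming (_/_ to _/ℚ_)
open import Data.Sum.Base using (_⊎_)
open import Data.Unit.Base using (⊤)
open import Function.Base using (_∘_)
open import Function.Bundles using (_⇔_)
open import Function.Definitions using (Injective)
open import Relation.Binary.PropositionalEquality using (_≡_; _≢_; refl; cong)
open import Relation.Nullary.Negation using (¬_)

d : ℕ → ℕ
d n = length (filter (_∣? n) (map suc (upTo n)))

d-nonZero : ∀ n → .{{NonZero n}} → NonZero (d n)
d-nonZero (suc n) rewrite filter-accept (_∣? suc n) {xs = map suc (applyUpTo suc n)} (1∣ suc n) = _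

-- The search bound is no restriction for prime q and positive x, since
-- q ^ e ∣ x forces e < q ^ e ≤ x.
v : ℕ → ℕ → ℕ
v q x = max 0 (filter (λ e → q ^ e ∣? x) (upTo (suc x)))

-- Totalised with m ÷ 0 = 0; only ever used with prime divisors.
_÷_ : ℕ → ℕ → ℕ
m ÷ zero      = 0
m ÷ n@(suc _) = m / n

HighlyComposite : ℕ → Set
HighlyComposite H = 1 ≤ H × (∀ m → 1 ≤ m → m < H → d m < d H)

record Consecutive (H H′ : ℕ) : Set where
  field
    source-hc  : HighlyComposite H
    target-hc  : HighlyComposite H′
    H<H′       : H < H′
    no-between : ∀ K → HighlyComposite K → ¬ (H < K × K < H′)

record OnlyLostPrime (H H′ r : ℕ) : Set where
  field
    r-prime  : Prime r
    a≡1      : v r H ≡ 1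
    b≡0      : v r H′ ≡ 0
    no-other : ∀ p → Prime p → p ≢ r → ¬ (0 < v p H × v p H′ ≡ 0)

record Layer : Set where
  constructor ⟨_,_⟩
  field
    base  : ℕ
    level : ℕ

open Layer public

RequiredDeletion : (H H′ : ℕ) → Layer → Set
RequiredDeletion H H′ ⟨ p , j ⟩ = Prime p × v p H′ < j × j ≤ v p H

RequiredInsertion : (H H′ : ℕ) → Layer → Set
RequiredInsertion H H′ ⟨ p , j ⟩ = Prime p × v p H < j × j ≤ v p H′

StackAdmissible : List Layer → Set
StackAdmissible = AllPairs (λ L M → base L ≡ base M → level L < level M)

-- The order condition also makes the listing repetition-free.
record ListsRemainingDeletions (H H′ r : ℕ) {k : ℕ} (D : Fin k → Layer) : Set where
  field
    complete : ∀ L → (∃[ i ] D i ≡ L) ⇔ (RequiredDeletion H H′ L × L ≢ ⟨ r , 1 ⟩)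
    ordered  : ∀ i h → base (D i) ≡ base (D h) → i Fin.< h → level (D h) < level (D i)

record MatchesInsertions (H H′ : ℕ) {k : ℕ} (I : Fin k → Layer) : Set where
  field
    required  : ∀ i → RequiredInsertion H H′ (I i)
    injective : Injective _≡_ _≡_ I

-- One exponent moves by one unit from z to w, towards its value in the target.
Step : (target z w : ℕ) → Set
Step target z w = ∃[ p ] Prime p
  × ((v p z < v p target × v p w ≡ suc (v p z)) ⊎ (v p target < v p z × suc (v p w) ≡ v p z))
  × (∀ q → Prime q → q ≢ p → v q w ≡ v q z)

record Geodesic (H H′ : ℕ) (γ : List⁺ ℕ) : Set where
  field
    starts   : head γ ≡ H
    ends     : last γ ≡ H′
    positive : All (1 ≤_) (toList γ)
    steps    : Linked (Step H′) (toList γ)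

AdmissibleGeodesic : (H H′ : ℕ) → List⁺ ℕ → Set
AdmissibleGeodesic H H′ γ = Geodesic H H′ γ × All (_≤ H′) (toList γ)

minDivisors : List⁺ ℕ → ℕ
minDivisors γ = foldr₁ _⊓_ (List⁺.map d γ)

record IsMaxMinDivisors (H H′ M : ℕ) : Set where
  field
    attained : ∃[ γ ] AdmissibleGeodesic H H′ γ × minDivisors γ ≡ M
    maximal  : ∀ γ → AdmissibleGeodesic H H′ γ → minDivisors γ ≤ M

-- The assertion β^geo(H,H′) = β; βgeo-unique shows that β is determined.
Isβgeo : (H H′ : ℕ) → .{{NonZero H}} → ℚ → Set
Isβgeo H H′ β = ∃[ M ] IsMaxMinDivisors H H′ M × β ≡ _/ℚ_ (+ M) (d H) {{d-nonZero H}}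

βgeo-unique : ∀ H H′ .{{_ : NonZero H}} {β β′} → Isβgeo H H′ β → Isβgeo H H′ β′ → β ≡ β′
βgeo-unique H H′ (M , m , refl) (N , n , refl) =
  cong (λ K → _/ℚ_ (+ K) (d H) {{d-nonZero H}}) (≤-antisym (le m n) (le n m))
  where
  open IsMaxMinDivisors
  le : ∀ {M N} → IsMaxMinDivisors H H′ M → IsMaxMinDivisors H H′ N → M ≤ N
  le m n with attained m
  ... | γ , adm , refl = maximal n γ adm

data Move : Set where
  insert delete : Layer → Move

apply : ℕ → Move → ℕ
apply z (insert L) = z * base L
apply z (delete L) = z ÷ base L

-- Applying the move to z really raises the exponent from j - 1 to j,
-- respectively lowers it from j to j - 1.
Legal : ℕ → Move → Set
Legal z (insert ⟨ q , j ⟩) = suc (v q z) ≡ j × v q (z * q) ≡ j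
Legal z (delete ⟨ p , j ⟩) = v p z ≡ j × suc (v p (z ÷ p)) ≡ j

Executable : ℕ → List Move → Set
Executable z []       = ⊤
Executable z (m ∷ ms) = Legal z m × Executable (apply z m) ms

vertices : ℕ → List Move → List⁺ ℕ
vertices = scanl⁺ apply

raiseTo : ℕ → Layer → ℕ
raiseTo z ⟨ q , j ⟩ = z * q ^ (j ∸ v q z)

stage : ℕ → Layer → Layer → ℕ
stage z D I = raiseTo z I ÷ base D

states : ∀ {k} → ℕ → (D I : Fin k → Layer) → Fin (suc k) → ℕ
states         x₀ D I zero    = x₀
states {suc k} x₀ D I (suc i) = states (stage x₀ (D zero) (I zero)) (D ∘ suc) (I ∘ suc) i

states-suc : ∀ {k} x₀ (D I : Fin k → Layer) i →
             states x₀ D I (suc i) ≡ stage (states x₀ D I (inject₁ i)) (D i) (I i)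
states-suc x₀ D I zero    = refl
states-suc x₀ D I (suc i) = states-suc (stage x₀ (D zero) (I zero)) (D ∘ suc) (I ∘ suc) i

-- Stages are numbered from 0: stage i : Fin k starts from x (inject₁ i), passes
-- through y i and ends in x (suc i).
module Schedule (H H′ r : ℕ) {k : ℕ} (D I : Fin k → Layer) where

  x : Fin (suc k) → ℕ
  x = states (H ÷ r) D I

  p A q j e y : Fin k → ℕ
  p i = base (D i)
  A i = level (D i)
  q i = base (I i)
  j i = level (I i)
  e i = v (q i) (x (inject₁ i))
  y i = x (inject₁ i) * q i ^ (j i ∸ e i)

  -- The insertions are those of the levels e i + 1, …, j i.
  stageMoves : Fin k → List Move
  stageMoves i = map (λ t → insert ⟨ q i , e i + suc t ⟩) (upTo (j i ∸ e i)) ++ [ delete (D i) ]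

  matchedMoves : List Move
  matchedMoves = concat (tabulate stageMoves)

  RemainingInsertions : List Layer → Set
  RemainingInsertions R = ∀ L → L ∈ R ⇔ (RequiredInsertion H H′ L × insert L ∉ matchedMoves)

  schedule : List Layer → List Move
  schedule R = delete ⟨ r , 1 ⟩ ∷ matchedMoves ++ map insert R

  NoLaterMatchedPrerequisite : Fin k → Set
  NoLaterMatchedPrerequisite i = ∀ m → e i < m → m < j i → ∀ h → i Fin.< h → I h ≢ ⟨ q i , m ⟩

{-# OPTIONS --safe #-}
module Submission where

-- Lower bound: after the loss of r halves the divisor count, a stage raising q
-- from e to j and lowering p from A to A - 1 multiplies it by
-- (j + 1)/(e + 1) · A/(A + 1) ≥ (j + 1)/j · A/(A + 1) ≥ 1 because e < j ≤ A, and
-- pure insertions only increase it.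
-- Upper bound: every geodesic crosses an edge z → z/r with r exactly dividing z.
-- Since r does not divide H′, z < H′, and a number below H′ with more divisors
-- than H would, taken minimal, be highly composite strictly between H and H′.
-- So d(z/r) = d(z)/2 ≤ d(H)/2.
-- For q > p, the level bound holds because the exponents of a highly composite
-- number are antitone in the prime: exchanging two exponents that violate this
-- gives a smaller number with as many divisors.

open import Defs
open import Data.Fin.Base as Fin using (Fin; inject₁)
open import Data.Fin.Properties using (¬Fin0)
open import Data.Integer.Base using () renaming (+_ to pos)
import Data.Integer.Properties as ℤ
open import Data.List.Base using (List; []; _∷_; [_]; _++_; _∷ʳ′_; map; filter; length; upTo; applyUpTo; concat; tabulate; initLast)
open import Data.List.Extrema.Nat using (max≤v⁺; xs≤max)
open import Data.List.Membership.Propositional using (_∈_; _∉_)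
open import Data.List.Membership.Propositional.Properties using (∈-map⁺; ∈-map⁻; ∈-++⁺ˡ; ∈-++⁺ʳ; ∈-++⁻; ∈-upTo⁺; ∈-filter⁺; ∈-filter⁻)
open import Data.List.Membership.Propositional.Properties.WithK using (unique∧set⇒bag)
open import Data.List.NonEmpty.Base using (List⁺; _∷_; last; toList)
open import Data.List.Properties using (length-++; length-map; map-upTo; map-∘)
open import Data.List.Relation.Binary.BagAndSetEquality using (∼bag⇒↭)
open import Data.List.Relation.Binary.Permutation.Propositional.Properties using (↭-length)
open import Data.List.Relation.Unary.All as All using (All; []; _∷_)
open import Data.List.Relation.Unary.AllPairs using ([]; _∷_)
open import Data.List.Relation.Unary.Any using (here; there)
open import Data.List.Relation.Unary.Linked using (Linked; [-]; _∷_)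
open import Data.List.Relation.Unary.Unique.Propositional using (Unique)
import Data.List.Relation.Unary.Unique.Propositional.Properties as Unique
open import Data.Nat.Base using (ℕ; zero; suc; _+_; _*_; _^_; _∸_; _≤_; _<_; z≤n; s≤s; NonZero; >-nonZero; >-nonZero⁻¹; nonTrivial⇒n>1)
open import Data.Nat.Divisibility
open import Data.Nat.DivMod using (m*n/n≡m)
open import Data.Nat.Induction using (<-rec)
open import Data.Nat.ListAction using (product)
open import Data.Nat.Primality using (Prime; prime⇒nonZero; prime⇒nonTrivial; prime⇒irreducible; euclidsLemma; productOfPrimes≢0)
open import Data.Nat.Primality.Factorisation using (PrimeFactorisation; factorise)
open import Data.Nat.Properties
open import Data.Nat.Tactic.RingSolver using (solve-∀)
open import Data.Product.Base using (_×_; _,_; ∃-syntax; proj₁; proj₂)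
open import Data.Rational.Base using (½) renaming (_/_ to _/ℚ_)
open import Data.Rational.Properties using (fromℚᵘ-cong)
open import Data.Rational.Unnormalised.Base using (mkℚᵘ; *≡*)
open import Data.Sum.Base using (_⊎_; inj₁; inj₂; [_,_]′)
open import Data.Unit.Base using (tt)
open import Function.Base using (_∘_)
open import Function.Bundles using (_⇔_; mk⇔; Equivalence)
open import Relation.Binary.PropositionalEquality using (_≡_; _≢_; refl; sym; trans; cong; cong₂; subst; subst₂; module ≡-Reasoning)
open import Relation.Nullary using (¬_; Dec; yes; no; contradiction)
open import Relation.Nullary.Decidable using (decidable-stable)

-- Prime exponents

prime>0 : ∀ {p} → Prime p → 0 < p
prime>0 pr = >-nonZero⁻¹ _ {{prime⇒nonZero pr}}

prime>1 : ∀ {p} → Prime p → 1 < p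
prime>1 pr = nonTrivial⇒n>1 _ {{prime⇒nonTrivial pr}}

prime^>0 : ∀ {p} → Prime p → ∀ n → 0 < p ^ n
prime^>0 pr n = m^n>0 _ {{prime⇒nonZero pr}} n

prime∤1 : ∀ {p} → Prime p → ¬ p ∣ 1
prime∤1 pr p∣1 = <⇒≢ (prime>1 pr) (sym (∣1⇒≡1 p∣1))

prime∣prime⇒≡ : ∀ {p q} → Prime p → Prime q → p ∣ q → p ≡ q
prime∣prime⇒≡ {p} pr qr p∣q with prime⇒irreducible qr p∣q
... | inj₁ refl = contradiction ∣-refl (prime∤1 pr)
... | inj₂ p≡q  = p≡q

prime∤* : ∀ {p m n} → Prime p → ¬ p ∣ m → ¬ p ∣ n → ¬ p ∣ m * n
prime∤* {m = m} {n} pr p∤m p∤n p∣mn = [ p∤m , p∤n ]′ (euclidsLemma m n pr p∣mn)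

prime∤prime^ : ∀ {p q} → Prime p → Prime q → q ≢ p → ∀ n → ¬ q ∣ p ^ n
prime∤prime^ pr qr q≢p zero    = prime∤1 qr
prime∤prime^ pr qr q≢p (suc n) = prime∤* qr (q≢p ∘ prime∣prime⇒≡ qr pr) (prime∤prime^ pr qr q≢p n)

∤⇒>0 : ∀ {p m} → ¬ p ∣ m → 0 < m
∤⇒>0 {p} {zero}  p∤m = contradiction (p ∣0) p∤m
∤⇒>0 {p} {suc m} p∤m = s≤s z≤n

prime^∣⇒≤ : ∀ {p m} → Prime p → ¬ p ∣ m → ∀ e f → p ^ f ∣ p ^ e * m → f ≤ e
prime^∣⇒≤ pr p∤m e zero h = z≤n
prime^∣⇒≤ {p} {m} pr p∤m zero (suc f) h =
  contradiction (subst (p ∣_) (*-identityˡ m) (∣-trans (m∣m*n (p ^ f)) h)) p∤m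
prime^∣⇒≤ {p} {m} pr p∤m (suc e) (suc f) h =
  s≤s (prime^∣⇒≤ pr p∤m e f (*-cancelˡ-∣ p {{prime⇒nonZero pr}} (subst (p ^ suc f ∣_) (*-assoc p (p ^ e) m) h)))

n<m^n : ∀ {m} → 1 < m → ∀ n → n < m ^ n
n<m^n 1<m zero = s≤s z≤n
n<m^n {m} 1<m (suc n) = begin
  2 + n         ≤⟨ +-monoʳ-≤ 1 (n<m^n 1<m n) ⟩
  1 + m ^ n     ≤⟨ +-monoˡ-≤ (m ^ n) (≤-trans (s≤s z≤n) (n<m^n 1<m n)) ⟩
  m ^ n + m ^ n ≡⟨ cong (m ^ n +_) (+-identityʳ (m ^ n)) ⟨
  2 * m ^ n     ≤⟨ *-monoˡ-≤ (m ^ n) 1<m ⟩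
  m ^ suc n     ∎
  where open ≤-Reasoning

-- The only place where the bounded search behind `v` is unfolded. An exponent that passes the
-- filter is at most `e` because `p` does not divide the cofactor; `e` itself lies in the search
-- range because `e < p ^ e ≤ x`.
v-^* : ∀ {p m} → Prime p → ¬ p ∣ m → ∀ e → v p (p ^ e * m) ≡ e
v-^* {p} {m} pr p∤m e = ≤-antisym
  (max≤v⁺ z≤n (All.tabulate λ {f} f∈ → prime^∣⇒≤ pr p∤m e f (proj₂ (∈-filter⁻ (λ f → p ^ f ∣? x) {xs = upTo (suc x)} f∈))))
  (All.lookup (xs≤max 0 (filter (λ f → p ^ f ∣? x) (upTo (suc x))))
    (∈-filter⁺ (λ f → p ^ f ∣? x) (∈-upTo⁺ (s≤s e≤x)) (m∣m*n m)))
  where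
  x = p ^ e * m
  e≤x : e ≤ x
  e≤x = ≤-trans (<⇒≤ (n<m^n (prime>1 pr) e)) (m≤m*n (p ^ e) m {{>-nonZero (∤⇒>0 p∤m)}})

-- The exponent is `v p x` itself instead of an unknown one, so exponents of products can be read
-- off directly. A splitting with any other name for the exponent is brought to this form by `v-^*`.
record PrimePart (p x : ℕ) : Set where
  constructor primePart
  field
    {cofactor} : ℕ
    coprime    : ¬ p ∣ cofactor
    splits     : x ≡ p ^ v p x * cofactor

splitPrime : ∀ {p x} → Prime p → 0 < x → PrimePart p x
splitPrime {p} pr = <-rec (λ x → 0 < x → PrimePart p x) split _
  where
  from : ∀ {x m} e → ¬ p ∣ m → x ≡ p ^ e * m → PrimePart p x
  from e p∤m refl = primePart p∤m (cong (λ f → p ^ f * _) (sym (v-^* pr p∤m e)))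

  split : ∀ x → (∀ {y} → y < x → 0 < y → PrimePart p y) → 0 < x → PrimePart p x
  split x rec x>0 with p ∣? x
  ... | no p∤x = from 0 p∤x (sym (*-identityˡ x))
  ... | yes p∣x@(divides y refl) with rec (quotient-< p∣x {{prime⇒nonTrivial pr}} {{>-nonZero x>0}})
                                          (>-nonZero⁻¹ y {{quotient≢0 p∣x {{>-nonZero x>0}}}})
  ...   | primePart {m} p∤m eq = from (suc (v p y)) p∤m
            (trans (cong (_* p) eq) (trans (*-comm _ p) (sym (*-assoc p (p ^ v p y) m))))

v-* : ∀ {p x y} → Prime p → 0 < x → 0 < y → v p (x * y) ≡ v p x + v p y
v-* {p} {x} {y} pr x>0 y>0 with splitPrime pr x>0 | splitPrime pr y>0
... | primePart {m} p∤m x≡ | primePart {n} p∤n y≡ = trans (cong (v p) xy≡) (v-^* pr (prime∤* pr p∤m p∤n) (v p x + v p y))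
  where
  shuffle : ∀ a m b n → (a * m) * (b * n) ≡ (a * b) * (m * n)
  shuffle = solve-∀
  xy≡ : x * y ≡ p ^ (v p x + v p y) * (m * n)
  xy≡ = trans (cong₂ _*_ x≡ y≡) (trans (shuffle (p ^ v p x) m (p ^ v p y) n)
          (cong (_* (m * n)) (sym (^-distribˡ-+-* p (v p x) (v p y)))))

∤⇒v≡0 : ∀ {p m} → Prime p → ¬ p ∣ m → v p m ≡ 0
∤⇒v≡0 {p} {m} pr p∤m = trans (cong (v p) (sym (*-identityˡ m))) (v-^* pr p∤m 0)

v>0⇒∣ : ∀ {p x} → Prime p → 0 < x → 0 < v p x → p ∣ x
v>0⇒∣ {p} {x} pr x>0 v>0 with p ∣? x
... | yes p∣x = p∣x
... | no  p∤x = contradiction (∤⇒v≡0 pr p∤x) (>⇒≢ v>0)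

v-*^-same : ∀ {p x} → Prime p → 0 < x → ∀ n → v p (x * p ^ n) ≡ v p x + n
v-*^-same {p} {x} pr x>0 n = trans (v-* pr x>0 (prime^>0 pr n))
  (cong (v p x +_) (trans (cong (v p) (sym (*-identityʳ (p ^ n)))) (v-^* pr (prime∤1 pr) n)))

v-*^-other : ∀ {p q x} → Prime p → Prime q → q ≢ p → 0 < x → ∀ n → v q (x * p ^ n) ≡ v q x
v-*^-other {p} {q} {x} pr qr q≢p x>0 n = trans (v-* qr x>0 (prime^>0 pr n))
  (trans (cong (v q x +_) (∤⇒v≡0 qr (prime∤prime^ pr qr q≢p n))) (+-identityʳ _))

v-*-same : ∀ {p x} → Prime p → 0 < x → v p (x * p) ≡ suc (v p x)
v-*-same {p} {x} pr x>0 = trans (cong (λ y → v p (x * y)) (sym (^-identityʳ p))) (trans (v-*^-same pr x>0 1) (+-comm _ 1))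

v-*-other : ∀ {p q x} → Prime p → Prime q → q ≢ p → 0 < x → v q (x * p) ≡ v q x
v-*-other {p} {q} {x} pr qr q≢p x>0 = trans (cong (λ y → v q (x * y)) (sym (^-identityʳ p))) (v-*^-other pr qr q≢p x>0 1)

*-÷ : ∀ {p} → 0 < p → ∀ x → (x * p) ÷ p ≡ x
*-÷ {suc p} _ x = m*n/n≡m x (suc p)

*>0 : ∀ {m n} → 0 < m → 0 < n → 0 < m * n
*>0 = *-mono-≤

v>0⇒÷ : ∀ {p x} → Prime p → 0 < x → 0 < v p x → 0 < x ÷ p × x ≡ (x ÷ p) * p
v>0⇒÷ {p} pr x>0 v>0 with v>0⇒∣ pr x>0 v>0
... | p∣x@(divides w refl) rewrite *-÷ (prime>0 pr) w = >-nonZero⁻¹ w {{quotient≢0 p∣x {{>-nonZero x>0}}}} , refl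

v-÷-same : ∀ {p x} → Prime p → 0 < x → 0 < v p x → suc (v p (x ÷ p)) ≡ v p x
v-÷-same {p} pr x>0 v>0 with v>0⇒÷ pr x>0 v>0
... | w>0 , eq = trans (sym (v-*-same pr w>0)) (cong (v p) (sym eq))

v-÷-other : ∀ {p q x} → Prime p → Prime q → q ≢ p → 0 < x → 0 < v p x → v q (x ÷ p) ≡ v q x
v-÷-other {q = q} pr qr q≢p x>0 v>0 with v>0⇒÷ pr x>0 v>0
... | w>0 , eq = trans (sym (v-*-other pr qr q≢p w>0)) (cong (v q) (sym eq))

∣⇒v≤ : ∀ {p x y} → Prime p → 0 < y → x ∣ y → v p x ≤ v p y
∣⇒v≤ {p} {x} pr y>0 x∣y@(divides c refl) = subst (v p x ≤_) (sym (v-* pr c>0 x>0)) (m≤n+m (v p x) (v p c))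
  where
  c>0 = >-nonZero⁻¹ c {{quotient≢0 x∣y {{>-nonZero y>0}}}}
  x>0 : 0 < x
  x>0 = >-nonZero⁻¹ x {{m*n≢0⇒n≢0 c {{>-nonZero y>0}}}}

-- Induction on a prime factorisation of `x`: each factor `p` also divides `y` by the hypothesis at
-- `p`. Since exponents are additive, cancelling `p` on both sides preserves the hypothesis for the
-- quotients.
v≤⇒∣ : ∀ {x y} → 0 < x → 0 < y → (∀ {p} → Prime p → v p x ≤ v p y) → x ∣ y
v≤⇒∣ {x} {y} x>0 y>0 v≤ = subst (_∣ y) (sym (isFactorisation fs))
  (go (factors fs) (factorsPrime fs) y>0 (λ {p} pr → subst (λ z → v p z ≤ v p y) (isFactorisation fs) (v≤ pr)))
  where
  open PrimeFactorisation
  fs = factorise x {{>-nonZero x>0}}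
  go : ∀ ps {y} → All Prime ps → 0 < y → (∀ {p} → Prime p → v p (product ps) ≤ v p y) → product ps ∣ y
  go [] _ _ _ = 1∣ _
  go (p ∷ ps) {y} (pr ∷ prs) y>0 v≤ with v>0⇒÷ pr y>0 vy>0
    where
    vy>0 : 0 < v p y
    vy>0 = ≤-trans (subst (0 <_) (sym (trans (cong (v p) (*-comm p (product ps)))
             (v-*-same pr (>-nonZero⁻¹ _ {{productOfPrimes≢0 prs}})))) (s≤s z≤n)) (v≤ pr)
  ... | w>0 , eq = subst (p * product ps ∣_) (trans (*-comm p _) (sym eq)) (*-monoʳ-∣ p (go ps prs w>0 v≤′))
    where
    v≤′ : ∀ {q} → Prime q → v q (product ps) ≤ v q (y ÷ p)
    v≤′ {q} qr = +-cancelˡ-≤ (v q p) _ _ (subst₂ _≤_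
      (v-* qr (prime>0 pr) (>-nonZero⁻¹ _ {{productOfPrimes≢0 prs}}))
      (trans (cong (v q) (trans eq (*-comm _ p))) (v-* qr (prime>0 pr) w>0)) (v≤ qr))

v≡⇒≡ : ∀ {x y} → 0 < x → 0 < y → (∀ {p} → Prime p → v p x ≡ v p y) → x ≡ y
v≡⇒≡ x>0 y>0 v≡ = ∣-antisym (v≤⇒∣ x>0 y>0 (≤-reflexive ∘ v≡)) (v≤⇒∣ y>0 x>0 (≤-reflexive ∘ sym ∘ v≡))

-- The divisor function

divisors : ℕ → List ℕ
divisors n = filter (_∣? n) (map suc (upTo n))

∈-divisors⁺ : ∀ {n t} → 0 < n → t ∣ n → t ∈ divisors n
∈-divisors⁺ {n} {zero} n>0 t∣n = contradiction (0∣⇒≡0 t∣n) (>⇒≢ n>0)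
∈-divisors⁺ {n} {suc t} n>0 t∣n = ∈-filter⁺ (_∣? n) (∈-map⁺ suc (∈-upTo⁺ (∣⇒≤ {{>-nonZero n>0}} t∣n))) t∣n

∈-divisors⁻ : ∀ n {t} → t ∈ divisors n → t ∣ n
∈-divisors⁻ n t∈ = proj₂ (∈-filter⁻ (_∣? n) {xs = map suc (upTo n)} t∈)

divisors-unique : ∀ n → Unique (divisors n)
divisors-unique n = Unique.filter⁺ (_∣? n) (Unique.map⁺ suc-injective (Unique.upTo⁺ n))

-- The case distinction is on the codivisor `c`. If `p` divides `c`, one factor `p` cancels;
-- otherwise all of `p ^ suc e` sits in `t`.
∣-prime^suc : ∀ {p m t} → Prime p → ¬ p ∣ m → ∀ e → t ∣ p ^ suc e * m →
              t ∣ p ^ e * m ⊎ ∃[ u ] u ∣ m × t ≡ p ^ suc e * u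
∣-prime^suc {p} {m} {t} pr p∤m e h@(divides c eq) with p ∣? c
... | yes (divides c′ refl) = inj₁ (divides c′ (*-cancelˡ-≡ _ _ p {{prime⇒nonZero pr}}
        (trans (sym (*-assoc p (p ^ e) m)) (trans eq (trans (cong (_* t) (*-comm c′ p)) (*-assoc p c′ t))))))
... | no p∤c = inj₂ (m′ , divides c (*-cancelˡ-≡ _ _ (p ^ suc e) {{m^n≢0 p (suc e) {{prime⇒nonZero pr}}}}
                 (trans eq (trans (cong (c *_) t≡) (shuffle c (p ^ suc e) m′)))) , t≡)
  where
  N>0 : 0 < p ^ suc e * m
  N>0 = *>0 (prime^>0 pr (suc e)) (∤⇒>0 p∤m)
  t>0 : 0 < t
  t>0 = >-nonZero⁻¹ t {{m*n≢0⇒n≢0 c {{>-nonZero (subst (0 <_) eq N>0)}}}}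
  m′ = PrimePart.cofactor (splitPrime pr t>0)
  v≡ : v p t ≡ suc e
  v≡ = trans (sym (cong (_+ v p t) (∤⇒v≡0 pr p∤c)))
         (trans (sym (v-* pr (∤⇒>0 p∤c) t>0)) (trans (cong (v p) (sym eq)) (v-^* pr p∤m (suc e))))
  t≡ : t ≡ p ^ suc e * m′
  t≡ = trans (PrimePart.splits (splitPrime pr t>0)) (cong (λ f → p ^ f * m′) v≡)
  shuffle : ∀ c a b → c * (a * b) ≡ a * (c * b)
  shuffle = solve-∀

-- The new divisors are the `p ^ suc e * u` with `u ∣ m`, disjoint from the old ones. Two
-- repetition-free lists with the same members are permutations of each other, which turns this into
-- an equation of lengths.
d-prime^suc : ∀ {p m} → Prime p → ¬ p ∣ m → ∀ e → d (p ^ suc e * m) ≡ d (p ^ e * m) + d m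
d-prime^suc {p} {m} pr p∤m e = trans (↭-length (∼bag⇒↭ (unique∧set⇒bag (divisors-unique (p ^ suc e * m)) unique (mk⇔ to from))))
  (trans (length-++ old) (cong (length old +_) (length-map (p ^ suc e *_) (divisors m))))
  where
  old new : List ℕ
  old = divisors (p ^ e * m)
  new = map (p ^ suc e *_) (divisors m)
  m>0 = ∤⇒>0 p∤m
  disjoint : ∀ {t} → ¬ (t ∈ old × t ∈ new)
  disjoint (t∈old , t∈new) with ∈-map⁻ (p ^ suc e *_) t∈new
  ... | u , _ , refl = 1+n≰n (prime^∣⇒≤ pr p∤m e (suc e) (∣-trans (m∣m*n u) (∈-divisors⁻ (p ^ e * m) t∈old)))
  unique : Unique (old ++ new)
  unique = Unique.++⁺ (divisors-unique (p ^ e * m))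
    (Unique.map⁺ (*-cancelˡ-≡ _ _ (p ^ suc e) {{m^n≢0 p (suc e) {{prime⇒nonZero pr}}}}) (divisors-unique m)) disjoint
  to : ∀ {t} → t ∈ divisors (p ^ suc e * m) → t ∈ old ++ new
  to t∈ with ∣-prime^suc pr p∤m e (∈-divisors⁻ (p ^ suc e * m) t∈)
  ... | inj₁ t∣ = ∈-++⁺ˡ (∈-divisors⁺ (*>0 (prime^>0 pr e) m>0) t∣)
  ... | inj₂ (u , u∣m , refl) = ∈-++⁺ʳ old (∈-map⁺ (p ^ suc e *_) (∈-divisors⁺ m>0 u∣m))
  from : ∀ {t} → t ∈ old ++ new → t ∈ divisors (p ^ suc e * m)
  from t∈ with ∈-++⁻ old t∈
  ... | inj₁ t∈old = ∈-divisors⁺ (*>0 (prime^>0 pr (suc e)) m>0)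
                       (∣-trans (∈-divisors⁻ (p ^ e * m) t∈old) (*-monoˡ-∣ m (n∣m*n p)))
  ... | inj₂ t∈new with ∈-map⁻ (p ^ suc e *_) t∈new
  ...   | u , u∈ , refl = ∈-divisors⁺ (*>0 (prime^>0 pr (suc e)) m>0) (*-monoʳ-∣ (p ^ suc e) (∈-divisors⁻ m u∈))

d-prime^ : ∀ {p m} → Prime p → ¬ p ∣ m → ∀ e → d (p ^ e * m) ≡ suc e * d m
d-prime^ {m = m} pr p∤m zero = trans (cong d (*-identityˡ m)) (sym (*-identityˡ (d m)))
d-prime^ {m = m} pr p∤m (suc e) = trans (d-prime^suc pr p∤m e)
  (trans (cong (_+ d m) (d-prime^ pr p∤m e)) (+-comm _ (d m)))

-- The ratio of the two divisor counts, `(v p x + n + 1) / (v p x + 1)`, cleared of denominators.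
d-*^ : ∀ {p x} → Prime p → 0 < x → ∀ n → d (x * p ^ n) * suc (v p x) ≡ d x * suc (v p x + n)
d-*^ {p} {x} pr x>0 n with splitPrime pr x>0
... | primePart {m} p∤m x≡ = begin
  d (x * p ^ n) * suc e         ≡⟨ cong (λ y → d y * suc e) xp≡ ⟩
  d (p ^ (e + n) * m) * suc e   ≡⟨ cong (_* suc e) (d-prime^ pr p∤m (e + n)) ⟩
  suc (e + n) * d m * suc e     ≡⟨ shuffle (suc (e + n)) (d m) (suc e) ⟩
  suc e * d m * suc (e + n)     ≡⟨ cong (_* suc (e + n)) (d-prime^ pr p∤m e) ⟨
  d (p ^ e * m) * suc (e + n)   ≡⟨ cong (λ y → d y * suc (e + n)) x≡ ⟨
  d x * suc (e + n)             ∎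
  where
  open ≡-Reasoning
  e = v p x
  shuffle : ∀ a b c → a * b * c ≡ c * b * a
  shuffle = solve-∀
  swap : ∀ a b c → a * b * c ≡ a * c * b
  swap = solve-∀
  xp≡ : x * p ^ n ≡ p ^ (e + n) * m
  xp≡ = trans (cong (_* p ^ n) x≡) (trans (swap (p ^ e) m (p ^ n)) (cong (_* m) (sym (^-distribˡ-+-* p e n))))

d-* : ∀ {p x} → Prime p → 0 < x → d (x * p) * suc (v p x) ≡ d x * suc (suc (v p x))
d-* {p} {x} pr x>0 = trans (cong (λ y → d (x * y) * suc (v p x)) (sym (^-identityʳ p)))
  (trans (d-*^ pr x>0 1) (cong (λ f → d x * suc f) (+-comm (v p x) 1)))

d≤d-* : ∀ {p x} → Prime p → 0 < x → d x ≤ d (x * p)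
d≤d-* {p} {x} pr x>0 = *-cancelʳ-≤ _ _ (suc (v p x))
  (subst (d x * suc (v p x) ≤_) (sym (d-* pr x>0)) (*-monoʳ-≤ (d x) (n≤1+n _)))

-- `last` is computed through `initLast` and does not reduce on a cons, so a case split is required.
last-∷ : ∀ (x y : ℕ) ys → last (x ∷ y ∷ ys) ≡ last (y ∷ ys)
last-∷ x y ys with initLast ys
... | []       = refl
... | _ ∷ʳ′ _ = refl


-- Executing moves towards a target

-- The part of legality and direction that cannot be derived: from it, for positive `z`, follow both
-- `Legal` and `Step`.
Toward : ℕ → ℕ → Move → Set
Toward T z (insert ⟨ q , j ⟩) = Prime q × suc (v q z) ≡ j × j ≤ v q T
Toward T z (delete ⟨ p , j ⟩) = Prime p × v p z ≡ j × v p T < j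

-- An execution with an invariant `P` at every vertex, endpoints included. One such object yields
-- executability, the geodesic steps, the last vertex and the bounds on all vertices.
data Run (T : ℕ) (P : ℕ → Set) : ℕ → List Move → ℕ → Set where
  done : ∀ {z} → P z → Run T P z [] z
  step : ∀ {z m ms w} → P z → Toward T z m → Run T P (apply z m) ms w → Run T P z (m ∷ ms) w

module _ {T : ℕ} where

  toward⇒>0 : ∀ {z} m → 0 < z → Toward T z m → 0 < apply z m
  toward⇒>0 (insert _) z>0 (qr , _ , _)        = *>0 z>0 (prime>0 qr)
  toward⇒>0 (delete _) z>0 (pr , refl , vT<vz) = proj₁ (v>0⇒÷ pr z>0 (≤-trans (s≤s z≤n) vT<vz))

  toward⇒legal : ∀ {z} m → 0 < z → Toward T z m → Legal z m
  toward⇒legal (insert _) z>0 (qr , refl , _)     = refl , v-*-same qr z>0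
  toward⇒legal (delete _) z>0 (pr , refl , vT<vz) = refl , v-÷-same pr z>0 (≤-trans (s≤s z≤n) vT<vz)

  toward⇒step : ∀ {z} m → 0 < z → Toward T z m → Step T z (apply z m)
  toward⇒step (insert ⟨ q , _ ⟩) z>0 (qr , refl , vz<vT) =
    q , qr , inj₁ (vz<vT , v-*-same qr z>0) , λ s sr s≢q → v-*-other qr sr s≢q z>0
  toward⇒step (delete ⟨ p , _ ⟩) z>0 (pr , refl , vT<vz) =
    p , pr , inj₂ (vT<vz , v-÷-same pr z>0 vz>0) , λ s sr s≢p → v-÷-other pr sr s≢p z>0 vz>0
    where vz>0 = ≤-trans (s≤s z≤n) vT<vz

  module _ {P : ℕ → Set} where

    run-++ : ∀ {z ms w ns u} → Run T P z ms w → Run T P w ns u → Run T P z (ms ++ ns) u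
    run-++ (done _)       t = t
    run-++ (step Pz to s) t = step Pz to (run-++ s t)

    run⇒end>0 : ∀ {z ms w} → 0 < z → Run T P z ms w → 0 < w
    run⇒end>0 z>0 (done _)               = z>0
    run⇒end>0 z>0 (step {m = m} _ to s) = run⇒end>0 (toward⇒>0 m z>0 to) s

    run⇒end : ∀ {z ms w} → Run T P z ms w → P w
    run⇒end (done Pz)    = Pz
    run⇒end (step _ _ s) = run⇒end s

    run⇒executable : ∀ {z ms w} → 0 < z → Run T P z ms w → Executable z ms
    run⇒executable z>0 (done _)              = tt
    run⇒executable z>0 (step {m = m} _ to s) = toward⇒legal m z>0 to , run⇒executable (toward⇒>0 m z>0 to) s

    run⇒all : ∀ {z ms w} → Run T P z ms w → All P (toList (vertices z ms))
    run⇒all (done Pz)     = Pz ∷ []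
    run⇒all (step Pz _ s) = Pz ∷ run⇒all s

    run⇒last : ∀ {z ms w} → Run T P z ms w → last (vertices z ms) ≡ w
    run⇒last (done _)     = refl
    run⇒last (step {z} {m} {ms} _ _ s) =
      trans (last-∷ z (apply z m) (List⁺.tail (vertices (apply z m) ms))) (run⇒last s)

    run⇒linked : ∀ {z ms w} → 0 < z → Run T P z ms w → Linked (Step T) (toList (vertices z ms))
    run⇒linked z>0 (done _)              = [-]
    run⇒linked z>0 (step {m = m} _ to s) = toward⇒step m z>0 to ∷ run⇒linked (toward⇒>0 m z>0 to) s

    -- Insertions never lower an exponent, and a deletion towards `T` leaves an exponent that is
    -- still at least its target, hence at least `l`.
    run-preserves-≤ : ∀ {z ms w s l} → Prime s → 0 < z → Run T P z ms w → l ≤ v s T → l ≤ v s z → l ≤ v s w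
    run-preserves-≤ sr z>0 (done _) l≤T l≤z = l≤z
    run-preserves-≤ {z} {s = s} {l} sr z>0 (step {m = m} _ to t) l≤T l≤z =
      run-preserves-≤ sr (toward⇒>0 m z>0 to) t l≤T (next m to)
      where
      next : ∀ m → Toward T z m → l ≤ v s (apply z m)
      next (insert ⟨ q , _ ⟩) (qr , _ , _) = ≤-trans l≤z (∣⇒v≤ {x = z} sr (*>0 z>0 (prime>0 qr)) (m∣m*n q))
      next (delete ⟨ p , _ ⟩) (pr , refl , vT<vz) with s ≟ p
      ... | yes refl = ≤-trans l≤T (≤-pred (subst (v p T <_) (sym (v-÷-same pr z>0 (≤-trans (s≤s z≤n) vT<vz))) vT<vz))
      ... | no s≢p   = subst (l ≤_) (sym (v-÷-other pr sr s≢p z>0 (≤-trans (s≤s z≤n) vT<vz))) l≤z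

    -- Exponents move by single units, so rising past `l` must insert exactly the level `l`. As long
    -- as the exponent of `s` is below `l ≤ v s T`, no deletion at `s` is possible. Together with
    -- `inserted⁻`, this lets the end state decide which layers a run has inserted.
    inserted⁺ : ∀ {z ms w s l} → Prime s → 0 < z → Run T P z ms w →
                v s z < l → l ≤ v s T → l ≤ v s w → insert ⟨ s , l ⟩ ∈ ms
    inserted⁺ sr z>0 (done _) z<l l≤T l≤z = contradiction l≤z (<⇒≱ z<l)
    inserted⁺ {s = s} {l} sr z>0 (step {m = insert ⟨ q , _ ⟩} _ to@(qr , refl , _) t) z<l l≤T l≤w with s ≟ q
    ... | no s≢q = there (inserted⁺ sr (toward⇒>0 (insert _) z>0 to) t
                     (subst (_< l) (sym (v-*-other qr sr s≢q z>0)) z<l) l≤T l≤w)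
    ... | yes refl with m≤n⇒m<n∨m≡n z<l
    ...   | inj₂ refl  = here refl
    ...   | inj₁ 1+z<l = there (inserted⁺ sr (toward⇒>0 (insert _) z>0 to) t
                           (subst (_< l) (sym (v-*-same qr z>0)) 1+z<l) l≤T l≤w)
    inserted⁺ {s = s} {l} sr z>0 (step {m = delete ⟨ p , _ ⟩} _ to@(pr , refl , vT<vz) t) z<l l≤T l≤w with s ≟ p
    ... | yes refl = contradiction (<-≤-trans z<l l≤T) (<⇒≯ vT<vz)
    ... | no s≢p   = there (inserted⁺ sr (toward⇒>0 (delete _) z>0 to) t
                       (subst (_< l) (sym (v-÷-other pr sr s≢p z>0 (≤-trans (s≤s z≤n) vT<vz))) z<l) l≤T l≤w)

    inserted⁻ : ∀ {z ms w s l} → 0 < z → Run T P z ms w → insert ⟨ s , l ⟩ ∈ ms → l ≤ v s w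
    inserted⁻ z>0 (step _ to@(sr , refl , l≤T) t) (here refl) =
      run-preserves-≤ sr (toward⇒>0 (insert _) z>0 to) t l≤T (≤-reflexive (sym (v-*-same sr z>0)))
    inserted⁻ z>0 (step {m = m} _ to t) (there L∈) = inserted⁻ (toward⇒>0 m z>0 to) t L∈

    insertions-≤ : ∀ {z w} R → Run T P z (map insert R) w → z ≤ w
    insertions-≤ []      (done _)                = ≤-refl
    insertions-≤ (L ∷ R) (step _ (qr , _ , _) s) =
      ≤-trans (m≤m*n _ (base L) {{prime⇒nonZero qr}}) (insertions-≤ R s)

-- The invariant of the schedule. It is used with `T` the target and `N` the divisor count of
-- `H ÷ r`.
record Good (T N z : ℕ) : Set where
  constructor good
  field
    good>0 : 0 < z
    good≤T : z ≤ T
    good-d : N ≤ d z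

open Good

module _ {T : ℕ} where

  -- The layers come as a function with a pointwise equation, so that the induction can pass to
  -- `f ∘ suc` while the starting exponent grows by one.
  levels-run : ∀ {q z} → Prime q → 0 < z → ∀ n (f : ℕ → Layer) → (∀ t → f t ≡ ⟨ q , v q z + suc t ⟩) →
               v q z + n ≤ v q T → Run T (0 <_) z (map insert (applyUpTo f n)) (z * q ^ n)
  levels-run {z = z} qr z>0 zero f f≡ ≤T = subst (Run T (0 <_) z []) (sym (*-identityʳ z)) (done z>0)
  levels-run {q} {z} qr z>0 (suc n) f f≡ ≤T rewrite f≡ 0 =
    step z>0 (qr , sym (+-comm (v q z) 1) , ≤-trans (+-monoʳ-≤ (v q z) (s≤s z≤n)) ≤T)
      (subst (Run T (0 <_) (z * q) (map insert (applyUpTo (f ∘ suc) n))) (*-assoc z q (q ^ n))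
        (levels-run qr (*>0 z>0 (prime>0 qr)) n (f ∘ suc)
          (λ t → trans (f≡ (suc t)) (cong ⟨ q ,_⟩ (shift (suc t))))
          (subst (_≤ v q T) (shift n) ≤T)))
    where
    shift : ∀ t → v q z + suc t ≡ v q (z * q) + t
    shift t = trans (+-suc (v q z) t) (cong (_+ t) (sym (v-*-same qr z>0)))

  -- Insertions increase the number and do not decrease its divisor count, so the upper bound has to
  -- be known only at the end and the lower bound only at the start.
  insertions-good : ∀ {N z w} R → Good T N z → w ≤ T → Run T (0 <_) z (map insert R) w →
                    Run T (Good T N) z (map insert R) w
  insertions-good []      g w≤T (done _) = done g
  insertions-good (L ∷ R) g@(good z>0 _ N≤d) w≤T (step _ to@(qr , _ , _) s) = step g to
    (insertions-good R (good (*>0 z>0 (prime>0 qr)) (≤-trans (insertions-≤ R s) w≤T) (≤-trans N≤d (d≤d-* qr z>0))) w≤T s)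

  -- Induction on `R`, which always lists exactly the layers missing between the current state and
  -- `T`. When none is missing, all exponents agree and the state is `T`.
  missing-run : ∀ R {z} → 0 < z → 0 < T → (∀ {s} → Prime s → v s z ≤ v s T) →
                (∀ L → L ∈ R ⇔ RequiredInsertion z T L) → StackAdmissible R →
                Run T (0 <_) z (map insert R) T
  missing-run [] {z} z>0 T>0 z≤T R⇔ _ = subst (Run T (0 <_) z []) (v≡⇒≡ z>0 T>0 v≡) (done z>0)
    where
    v≡ : ∀ {s} → Prime s → v s z ≡ v s T
    v≡ {s} sr = ≤-antisym (z≤T sr) (≮⇒≥ λ z<T →
      contradiction (Equivalence.from (R⇔ ⟨ s , v s T ⟩) (sr , z<T , ≤-refl)) λ ())
  missing-run (L@(⟨ q , l ⟩) ∷ R) {z} z>0 T>0 z≤T R⇔ (L< ∷ stack) with Equivalence.to (R⇔ L) (here refl)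
  ... | qr , z<l , l≤T = step z>0 (qr , l≡ , l≤T)
          (missing-run R (*>0 z>0 (prime>0 qr)) T>0 zq≤T (λ M → mk⇔ (to M) (from M)) stack)
    where
    l≡ : suc (v q z) ≡ l
    -- The next level in coordinate `q` is missing, hence listed. Were it listed later, stack order
    -- would place `l` below it, although `l` already exceeds `v q z`.
    l≡ with Equivalence.from (R⇔ ⟨ q , suc (v q z) ⟩) (qr , ≤-refl , ≤-trans z<l l≤T)
    ... | here refl = refl
    ... | there M∈R = contradiction (All.lookup L< M∈R refl) (≤⇒≯ z<l)
    vq≡ : v q (z * q) ≡ l
    vq≡ = trans (v-*-same qr z>0) l≡
    zq≤T : ∀ {s} → Prime s → v s (z * q) ≤ v s T
    zq≤T {s} sr with s ≟ q
    ... | yes refl = subst (_≤ v s T) (sym vq≡) l≤T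
    ... | no s≢q   = subst (_≤ v s T) (sym (v-*-other qr sr s≢q z>0)) (z≤T sr)
    to : ∀ M → M ∈ R → RequiredInsertion (z * q) T M
    to M@(⟨ s , m ⟩) M∈R with Equivalence.to (R⇔ M) (there M∈R)
    ... | sr , z<m , m≤T = sr , zq<m , m≤T
      where
      zq<m : v s (z * q) < m
      zq<m with s ≟ q
      ... | yes refl = subst (_< m) (sym vq≡) (All.lookup L< M∈R refl)
      ... | no s≢q   = subst (_< m) (sym (v-*-other qr sr s≢q z>0)) z<m
    from : ∀ M → RequiredInsertion (z * q) T M → M ∈ R
    from M@(⟨ s , m ⟩) (sr , zq<m , m≤T)
      with Equivalence.from (R⇔ M) (sr , ≤-<-trans (∣⇒v≤ {x = z} sr (*>0 z>0 (prime>0 qr)) (m∣m*n q)) zq<m , m≤T)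
    ... | here refl = contradiction vq≡ (<⇒≢ zq<m)
    ... | there M∈R = M∈R

  factors-run : ∀ {z} ps → All Prime ps → 0 < z → 0 < T → z * product ps ≡ T →
                ∃[ R ] Run T (0 <_) z (map insert R) T
  factors-run {z} [] _ z>0 T>0 eq = [] , subst (Run T (0 <_) z []) (trans (sym (*-identityʳ z)) eq) (done z>0)
  factors-run {z} (p ∷ ps) (pr ∷ prs) z>0 T>0 eq
    with factors-run ps prs (*>0 z>0 (prime>0 pr)) T>0 (trans (*-assoc z p (product ps)) eq)
  ... | R , s = ⟨ p , suc (v p z) ⟩ ∷ R , step z>0 (pr , refl , subst (_≤ v p T) (v-*-same pr z>0)
                  (∣⇒v≤ {x = z * p} pr T>0 (subst (z * p ∣_) (trans (*-assoc z p (product ps)) eq) (m∣m*n (product ps))))) s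

  -- Provides some order of the remaining insertions when none is given: the prime factors of the
  -- quotient of `T` by `z`, in the order of a factorisation.
  completion : ∀ {z} → 0 < z → 0 < T → (∀ {s} → Prime s → v s z ≤ v s T) →
               ∃[ R ] Run T (0 <_) z (map insert R) T
  completion {z} z>0 T>0 z≤T with v≤⇒∣ z>0 T>0 z≤T
  ... | z∣T@(divides c eq) = factors-run (factors fs) (factorsPrime fs) z>0 T>0
          (trans (cong (z *_) (sym (isFactorisation fs))) (trans (*-comm z c) (sym eq)))
    where
    open PrimeFactorisation
    fs = factorise c {{quotient≢0 z∣T {{>-nonZero T>0}}}}

-- The matched stages

-- Relative to the current state `x`, without an exceptional layer, so that the property is
-- inherited by the end of a stage and the shortened listing.
record ListsDeletions (x T : ℕ) {k : ℕ} (D : Fin k → Layer) : Set where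
  field
    complete : ∀ L → (∃[ i ] D i ≡ L) ⇔ RequiredDeletion x T L
    ordered  : ∀ i h → base (D i) ≡ base (D h) → i Fin.< h → level (D h) < level (D i)

-- `X`, `Y`, `W` are the divisor counts before a stage, after its insertions and after its deletion;
-- the two equations are their ratios without denominators. The core is `(A + 1) * (e + 1) ≤ (A + 1)
-- * j ≤ A * (j + 1)`.
≤-from-ratios : ∀ X Y W e j A → Y * A ≡ W * suc A → Y * suc e ≡ X * suc j → e < j → j ≤ A → X ≤ W
≤-from-ratios X Y W e j A YA≡ Ye≡ e<j j≤A = *-cancelʳ-≤ X W (suc A * suc e) (begin
  X * (suc A * suc e)   ≤⟨ *-monoʳ-≤ X (*-monoʳ-≤ (suc A) e<j) ⟩
  X * (suc A * j)       ≤⟨ *-monoʳ-≤ X (+-monoˡ-≤ (A * j) j≤A) ⟩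
  X * (A + A * j)       ≡⟨ comm X A j ⟩
  X * suc j * A         ≡⟨ cong (_* A) Ye≡ ⟨
  Y * suc e * A         ≡⟨ swap Y (suc e) A ⟩
  Y * A * suc e         ≡⟨ cong (_* suc e) YA≡ ⟩
  W * suc A * suc e     ≡⟨ *-assoc W (suc A) (suc e) ⟩
  W * (suc A * suc e)   ∎)
  where
  open ≤-Reasoning
  comm : ∀ X A j → X * (A + A * j) ≡ X * suc j * A
  comm = solve-∀
  swap : ∀ a b c → a * b * c ≡ a * c * b
  swap = solve-∀

-- The moves of `stageMoves` with the state as a parameter, so that an induction on the number of
-- stages can change the initial state.
movesOfStage : ℕ → Layer → Layer → List Move
movesOfStage x D ⟨ q , j ⟩ = map (λ t → insert ⟨ q , v q x + suc t ⟩) (upTo (j ∸ v q x)) ++ [ delete D ]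

module Stage {T N x p A q j : ℕ} (g : Good T N x)
             (pr : Prime p) (T<A : v p T < A) (vp≡ : v p x ≡ A)
             (qr : Prime q) (x<j : v q x < j) (j≤T : j ≤ v q T) (j≤A : j ≤ A)
             (y≤T : x * q ^ (j ∸ v q x) ≤ T) where

  y w : ℕ
  y = x * q ^ (j ∸ v q x)
  w = stage x ⟨ p , A ⟩ ⟨ q , j ⟩

  y>0 : 0 < y
  y>0 = *>0 (good>0 g) (prime^>0 qr (j ∸ v q x))

  p≢q : p ≢ q
  -- At `x` the exponent of `p` is above its target and that of `q` below.
  p≢q refl = <⇒≱ (<-≤-trans T<A (≤-reflexive (sym vp≡))) (<⇒≤ (<-≤-trans x<j j≤T))

  vy-p : v p y ≡ A
  vy-p = trans (v-*^-other qr pr p≢q (good>0 g) (j ∸ v q x)) vp≡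

  vy-q : v q x + (j ∸ v q x) ≡ j
  vy-q = m+[n∸m]≡n (<⇒≤ x<j)

  vy>0 : 0 < v p y
  vy>0 = subst (0 <_) (sym vy-p) (≤-trans (s≤s z≤n) T<A)

  w>0 : 0 < w
  w>0 = proj₁ (v>0⇒÷ pr y>0 vy>0)

  y≡ : y ≡ w * p
  y≡ = proj₂ (v>0⇒÷ pr y>0 vy>0)

  vw-p : suc (v p w) ≡ A
  vw-p = trans (v-÷-same pr y>0 vy>0) vy-p

  vw-q : v q w ≡ j
  vw-q = trans (v-÷-other pr qr (p≢q ∘ sym) y>0 vy>0) (trans (v-*^-same qr (good>0 g) (j ∸ v q x)) vy-q)

  vw-other : ∀ {s} → Prime s → s ≢ p → s ≢ q → v s w ≡ v s x
  vw-other sr s≢p s≢q = trans (v-÷-other pr sr s≢p y>0 vy>0) (v-*^-other qr sr s≢q (good>0 g) (j ∸ v q x))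

  dx≤dw : d x ≤ d w
  dx≤dw = ≤-from-ratios (d x) (d y) (d w) (v q x) j A
    -- The deletion is read backwards, as multiplication of `w` by `p`; the exponent of `p` in `w`
    -- is `A - 1`, which gives the factors `A` and `A + 1`.
    (subst (λ a → d y * a ≡ d w * suc a) vw-p (trans (cong (λ u → d u * suc (v p w)) y≡) (d-* pr w>0)))
    (trans (d-*^ qr (good>0 g) (j ∸ v q x)) (cong (λ a → d x * suc a) vy-q)) x<j j≤A

  good-w : Good T N w
  good-w = good w>0 (≤-trans (subst (w ≤_) (sym y≡) (m≤m*n w p {{prime⇒nonZero pr}})) y≤T) (≤-trans (good-d g) dx≤dw)

  run : Run T (Good T N) x (movesOfStage x ⟨ p , A ⟩ ⟨ q , j ⟩) w
  run = run-++ raise (step (run⇒end raise) (pr , vy-p , T<A) (done good-w))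
    where
    n = j ∸ v q x
    f : ℕ → Layer
    f t = ⟨ q , v q x + suc t ⟩
    raise : Run T (Good T N) x (map (insert ∘ f) (upTo n)) y
    raise = subst (λ ms → Run T (Good T N) x ms y) (trans (cong (map insert) (sym (map-upTo f n))) (sym (map-∘ (upTo n))))
      (insertions-good (applyUpTo f n) g y≤T
        (levels-run qr (good>0 g) n f (λ _ → refl) (subst (_≤ v q T) (sym vy-q) j≤T)))

module _ {T k x : ℕ} {D : Fin (suc k) → Layer} (lists : ListsDeletions x T D) where

  open ListsDeletions lists

  private
    p A : ℕ
    p = base (D Fin.zero)
    A = level (D Fin.zero)

  first-deletion-required : RequiredDeletion x T (D Fin.zero)
  first-deletion-required = Equivalence.to (complete (D Fin.zero)) (Fin.zero , refl)

  later-deletion-lower : ∀ {l} i → D (Fin.suc i) ≡ ⟨ p , l ⟩ → l < A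
  later-deletion-lower i eq = subst (_< A) (cong level eq)
    (ordered Fin.zero (Fin.suc i) (sym (cong base eq)) (s≤s z≤n))

  -- The layer at level `v p x` is itself a required deletion, hence listed, and no listed layer at
  -- `p` has a level above that of the first one.
  first-deletion-top : v p x ≡ A
  first-deletion-top = ≤-antisym
    (top≤ (Equivalence.from (complete ⟨ p , v p x ⟩) (pr , <-≤-trans T<A A≤x , ≤-refl))) A≤x
    where
    pr  = proj₁ first-deletion-required
    T<A = proj₁ (proj₂ first-deletion-required)
    A≤x = proj₂ (proj₂ first-deletion-required)
    top≤ : (∃[ i ] D i ≡ ⟨ p , v p x ⟩) → v p x ≤ A
    top≤ (Fin.zero  , eq) = ≤-reflexive (sym (cong level eq))
    top≤ (Fin.suc i , eq) = <⇒≤ (later-deletion-lower i eq)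

  module FirstStage {N q j : ℕ} (g : Good T N x) (qr : Prime q) (x<j : v q x < j) (j≤T : j ≤ v q T)
                    (j≤A : j ≤ A) (y≤T : x * q ^ (j ∸ v q x) ≤ T) where

    open Stage g (proj₁ first-deletion-required) (proj₁ (proj₂ first-deletion-required)) first-deletion-top
               qr x<j j≤T j≤A y≤T public

    -- The stage uses up exactly the layer at level `A`: the later layers at `p` are lower and
    -- remain. Coordinate `q` has no deletion layers before or after, since its exponent does not
    -- exceed the target, and all other coordinates are unchanged.
    lists-tail : ListsDeletions w T (D ∘ Fin.suc)
    lists-tail = record
      { complete = λ L → mk⇔ (to L) (from L)
      ; ordered  = λ i h eq i<h → ordered (Fin.suc i) (Fin.suc h) eq (s≤s i<h)
      }
      where
      to : ∀ L → (∃[ i ] D (Fin.suc i) ≡ L) → RequiredDeletion w T L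
      to L@(⟨ s , l ⟩) (i , eq) = sr , T<l , l≤w (s ≟ p) (s ≟ q)
        where
        required : RequiredDeletion x T L
        required = Equivalence.to (complete L) (Fin.suc i , eq)
        sr  = proj₁ required
        T<l = proj₁ (proj₂ required)
        l≤x = proj₂ (proj₂ required)
        l≤w : Dec (s ≡ p) → Dec (s ≡ q) → l ≤ v s w
        l≤w (yes refl) _          = ≤-pred (subst (l <_) (sym vw-p) (later-deletion-lower i eq))
        l≤w (no _)     (yes refl) = contradiction (<-≤-trans T<l l≤x) (≤⇒≯ (<⇒≤ (<-≤-trans x<j j≤T)))
        l≤w (no s≢p)   (no s≢q)   = subst (l ≤_) (sym (vw-other sr s≢p s≢q)) l≤x
      from : ∀ L → RequiredDeletion w T L → ∃[ i ] D (Fin.suc i) ≡ L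
      from L@(⟨ s , l ⟩) (sr , T<l , l≤w) = not-first (Equivalence.from (complete L) (sr , T<l , l≤x (s ≟ p) (s ≟ q)))
        where
        l≤x : Dec (s ≡ p) → Dec (s ≡ q) → l ≤ v s x
        l≤x (yes refl) _          = ≤-trans l≤w (≤-trans (n≤1+n (v p w)) (≤-reflexive (trans vw-p (sym first-deletion-top))))
        l≤x (no _)     (yes refl) = contradiction (<-≤-trans T<l (subst (l ≤_) vw-q l≤w)) (≤⇒≯ j≤T)
        l≤x (no s≢p)   (no s≢q)   = subst (l ≤_) (vw-other sr s≢p s≢q) l≤w
        not-first : (∃[ i ] D i ≡ L) → ∃[ i ] D (Fin.suc i) ≡ L
        not-first (Fin.zero  , refl) = contradiction vw-p (>⇒≢ (s≤s l≤w))
        not-first (Fin.suc i , eq)   = i , eq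

module _ {T N : ℕ} where

  matched-run : ∀ {k} x (D I : Fin k → Layer) → Good T N x → ListsDeletions x T D →
    (∀ i → Prime (base (I i)) × level (I i) ≤ v (base (I i)) T) →
    (∀ i → v (base (I i)) (states x D I (inject₁ i)) < level (I i)) →
    (∀ i → raiseTo (states x D I (inject₁ i)) (I i) ≤ T) →
    (∀ i → level (I i) ≤ level (D i)) →
    ∃[ w ] Run T (Good T N) x (concat (tabulate λ i → movesOfStage (states x D I (inject₁ i)) (D i) (I i))) w
         × (∀ {s} → Prime s → v s w ≤ v s T)
  -- An exponent above its target would be a required deletion, listed by an element of `Fin 0`.
  matched-run {zero} x D I g lists _ _ _ _ = x , done g , λ {s} sr → ≮⇒≥ λ T<x →
    ¬Fin0 (proj₁ (Equivalence.from (ListsDeletions.complete lists ⟨ s , v s x ⟩) (sr , T<x , ≤-refl)))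
  matched-run {suc k} x D I g lists I-required e<j y≤T j≤A =
    let u , s , u≤T = matched-run w (D ∘ Fin.suc) (I ∘ Fin.suc) good-w lists-tail
                        (I-required ∘ Fin.suc) (e<j ∘ Fin.suc) (y≤T ∘ Fin.suc) (j≤A ∘ Fin.suc)
    in u , run-++ run s , u≤T
    where
    open FirstStage lists g (proj₁ (I-required Fin.zero)) (e<j Fin.zero) (proj₂ (I-required Fin.zero))
                    (j≤A Fin.zero) (y≤T Fin.zero)

-- Highly composite numbers

-- Strong induction replaces the choice of a minimal counterexample: if `d H < d z`, the bound for
-- all smaller numbers makes `z` highly composite.
d≤d-source : ∀ {H H′} → Consecutive H H′ → ∀ {z} → 0 < z → z < H′ → d z ≤ d H
d≤d-source {H} {H′} con = <-rec (λ z → 0 < z → z < H′ → d z ≤ d H) bound _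
  where
  open Consecutive con
  bound : ∀ z → (∀ {m} → m < z → 0 < m → m < H′ → d m ≤ d H) → 0 < z → z < H′ → d z ≤ d H
  bound z rec z>0 z<H′ = ≮⇒≥ λ dH<dz →
    no-between z (z>0 , λ m m>0 m<z → ≤-<-trans (rec m<z m>0 (<-trans m<z z<H′)) dH<dz)
      (≰⇒> (λ z≤H → <⇒≱ dH<dz (d≤ (m≤n⇒m<n∨m≡n z≤H))) , z<H′)
    where
    d≤ : z < H ⊎ z ≡ H → d z ≤ d H
    d≤ (inj₁ z<H)  = <⇒≤ (proj₂ source-hc z z>0 z<H)
    d≤ (inj₂ refl) = ≤-refl

hc-exponents-antitone : ∀ {T p q} → HighlyComposite T → Prime p → Prime q → p < q → v q T ≤ v p T
hc-exponents-antitone {T} {p} {q} (T>0 , T-hc) pr qr p<q = ≮⇒≥ λ a<b → <⇒≢ (T-hc swapped swapped>0 (swapped<T a<b)) d≡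
  where
  open PrimePart (splitPrime qr T>0) renaming (cofactor to m; coprime to q∤m; splits to T≡)
  open PrimePart (splitPrime pr (∤⇒>0 q∤m)) renaming (cofactor to n; coprime to p∤n; splits to m≡)
  a = v p T
  b = v q T
  p≢q : p ≢ q
  p≢q = <⇒≢ p<q
  vm≡ : v p m ≡ a
  vm≡ = trans (sym (v-*^-other qr pr p≢q (∤⇒>0 q∤m) b)) (cong (v p) (trans (*-comm m (q ^ b)) (sym T≡)))
  T≡′ : T ≡ q ^ b * (p ^ a * n)
  T≡′ = trans T≡ (cong (q ^ b *_) (trans m≡ (cong (λ f → p ^ f * n) vm≡)))
  q∤n : ¬ q ∣ n
  q∤n q∣n = q∤m (subst (q ∣_) (sym m≡) (∣n⇒∣m*n (p ^ v p m) q∣n))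
  q∤p^n : ∀ e → ¬ q ∣ p ^ e * n
  q∤p^n e = prime∤* qr (prime∤prime^ pr qr (p≢q ∘ sym) e) q∤n
  swapped : ℕ
  swapped = q ^ a * (p ^ b * n)
  swapped>0 : 0 < swapped
  swapped>0 = *>0 (prime^>0 qr a) (∤⇒>0 (q∤p^n b))
  d-form : ∀ e f → d (q ^ e * (p ^ f * n)) ≡ suc e * (suc f * d n)
  d-form e f = trans (d-prime^ qr (q∤p^n f) e) (cong (suc e *_) (d-prime^ pr p∤n f))
  comm : ∀ x y z → x * (y * z) ≡ y * (x * z)
  comm = solve-∀
  d≡ : d swapped ≡ d T
  d≡ = trans (d-form a b) (trans (comm (suc a) (suc b) (d n)) (sym (trans (cong d T≡′) (d-form b a))))
  regroup : ∀ Q P Pc n → Q * (P * Pc * n) ≡ Q * P * n * Pc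
  regroup = solve-∀
  regroup′ : ∀ Q P Qc n → Q * Qc * (P * n) ≡ Q * P * n * Qc
  regroup′ = solve-∀
  swapped<T : a < b → swapped < T
  swapped<T a<b = begin-strict
    q ^ a * (p ^ b * n)               ≡⟨ cong (λ f → q ^ a * (p ^ f * n)) a+c≡b ⟨
    q ^ a * (p ^ (a + c) * n)         ≡⟨ cong (λ f → q ^ a * (f * n)) (^-distribˡ-+-* p a c) ⟩
    q ^ a * (p ^ a * p ^ c * n)       ≡⟨ regroup (q ^ a) (p ^ a) (p ^ c) n ⟩
    -- With the common factor split off, the exchange trades `q ^ c` for `p ^ c`, where `c = b ∸ a`
    -- is positive.
    q ^ a * p ^ a * n * p ^ c         <⟨ *-monoʳ-< (q ^ a * p ^ a * n) {{>-nonZero common>0}}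
                                           (^-monoˡ-< c {{>-nonZero (m<n⇒0<n∸m a<b)}} p<q) ⟩
    q ^ a * p ^ a * n * q ^ c         ≡⟨ regroup′ (q ^ a) (p ^ a) (q ^ c) n ⟨
    q ^ a * q ^ c * (p ^ a * n)       ≡⟨ cong (_* (p ^ a * n)) (^-distribˡ-+-* q a c) ⟨
    q ^ (a + c) * (p ^ a * n)         ≡⟨ cong (λ f → q ^ f * (p ^ a * n)) a+c≡b ⟩
    q ^ b * (p ^ a * n)               ≡⟨ T≡′ ⟨
    T                                 ∎
    where
    open ≤-Reasoning
    c = b ∸ a
    a+c≡b : a + c ≡ b
    a+c≡b = m+[n∸m]≡n (<⇒≤ a<b)
    common>0 : 0 < q ^ a * p ^ a * n
    common>0 = *>0 (*>0 (prime^>0 qr a) (prime^>0 pr a)) (∤⇒>0 p∤n)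

-- The bottleneck

minDivisors≤ : ∀ {w} z zs → w ∈ z ∷ zs → minDivisors (z ∷ zs) ≤ d w
minDivisors≤ z []       (here refl) = ≤-refl
minDivisors≤ z (_ ∷ _)  (here refl) = m⊓n≤m (d z) _
minDivisors≤ z (y ∷ ys) (there w∈)  = ≤-trans (m⊓n≤n (d z) (minDivisors (y ∷ ys))) (minDivisors≤ y ys w∈)

≤minDivisors : ∀ {N} z zs → All (λ w → N ≤ d w) (z ∷ zs) → N ≤ minDivisors (z ∷ zs)
≤minDivisors z []       (N≤ ∷ _)  = N≤
≤minDivisors z (y ∷ ys) (N≤ ∷ ≤s) = ⊓-glb N≤ (≤minDivisors y ys ≤s)

-- The edge sought enters the first vertex `w` whose `r`-exponent is zero. Its step must be in
-- coordinate `r`, since it changes that exponent, and downwards, since the target exponent is zero;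
-- comparing all exponents then identifies the predecessor as `w * r`.
losing-edge : ∀ T {r} → Prime r → v r T ≡ 0 → ∀ z zs → All (0 <_) (z ∷ zs) → Linked (Step T) (z ∷ zs) →
              0 < v r z → v r (last (z ∷ zs)) ≡ 0 →
              ∃[ w ] w ∈ z ∷ zs × w * r ∈ z ∷ zs × 0 < w × v r w ≡ 0
losing-edge T rr rT≡0 z [] _ _ z>0 last≡0 = contradiction last≡0 (>⇒≢ z>0)
losing-edge T {r} rr rT≡0 z (w ∷ ws) (z-pos ∷ w-pos ∷ ws-pos) ((p , pr , moved , fixed) ∷ links) vz>0 last≡0 = cases (v r w ≟ 0)
  where
  p≡r : v r w ≡ 0 → r ≡ p
  p≡r vw≡0 = decidable-stable (r ≟ p) λ r≢p → >⇒≢ vz>0 (trans (sym (fixed r rr r≢p)) vw≡0)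
  falls : r ≡ p → suc (v r w) ≡ v r z
  falls refl = [ (λ (z<T , _) → contradiction (<-≤-trans z<T (≤-reflexive rT≡0)) λ ()) , proj₂ ]′ moved
  z≡ : v r w ≡ 0 → w * r ≡ z
  z≡ vw≡0 = v≡⇒≡ (*>0 w-pos (prime>0 rr)) z-pos λ {s} sr → agree sr (s ≟ r)
    where
    agree : ∀ {s} → Prime s → Dec (s ≡ r) → v s (w * r) ≡ v s z
    agree sr (yes refl) = trans (v-*-same rr w-pos) (falls (p≡r vw≡0))
    agree {s} sr (no s≢r) = trans (v-*-other rr sr s≢r w-pos)
      (fixed s sr λ s≡p → s≢r (trans s≡p (sym (p≡r vw≡0))))
  cases : Dec (v r w ≡ 0) → ∃[ w′ ] w′ ∈ z ∷ w ∷ ws × w′ * r ∈ z ∷ w ∷ ws × 0 < w′ × v r w′ ≡ 0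
  cases (yes vw≡0) = w , there (here refl) , here (z≡ vw≡0) , w-pos , vw≡0
  cases (no vw≢0)  =
    let w′ , w∈ , wr∈ , w>0 , vw≡0 = losing-edge T rr rT≡0 w ws (w-pos ∷ ws-pos) links (n≢0⇒n>0 vw≢0)
                                       (trans (cong (v r) (sym (last-∷ z w ws))) last≡0)
    in w′ , there w∈ , there wr∈ , w>0 , vw≡0

d-*-new : ∀ {p x} → Prime p → 0 < x → v p x ≡ 0 → d (x * p) ≡ d x * 2
d-*-new {p} {x} pr x>0 vx≡0 = trans (sym (*-identityʳ _))
  (subst (λ e → d (x * p) * suc e ≡ d x * suc (suc e)) vx≡0 (d-* pr x>0))

half : ∀ M n .{{_ : NonZero n}} → n ≡ M * 2 → ½ ≡ pos M /ℚ n
-- Compared before normalisation by cross-multiplying; `mkℚᵘ` stores the denominator minus one, so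
-- the first fraction is one half.
half M (suc n) n≡2M = fromℚᵘ-cong {mkℚᵘ (pos 1) 1} {mkℚᵘ (pos M) n}
  (*≡* (trans (ℤ.*-identityˡ (pos (suc n))) (trans (cong pos n≡2M) (ℤ.pos-* M 2))))

theorem6p8 : ∀ (H H′ : ℕ) .{{_ : NonZero H}} → Consecutive H H′ →
    ∀ (r : ℕ) → OnlyLostPrime H H′ r →
    ∀ (k : ℕ) (D I : Fin k → Layer) →
    ListsRemainingDeletions H H′ r D →
    MatchesInsertions H H′ I →
    let open Schedule H H′ r D I in
    ( (∀ i → e i < j i) →
    (∀ i → NoLaterMatchedPrerequisite i) →
    (∀ i → y i ≤ H) →
    (∀ i → j i ≤ A i) →
    ( (∀ (R : List Layer) → RemainingInsertions R → StackAdmissible R →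
    Executable H (schedule R) × AdmissibleGeodesic H H′ (vertices H (schedule R)))
    × Isβgeo H H′ ½ ) )
    × (∀ i → p i < q i → j i ≤ A i)
theorem6p8 H H′ con r lost k D I lists matches =
  (λ e<j _ y≤H j≤A → schedule-works e<j y≤H j≤A , capacity e<j y≤H j≤A) , level≤
  where
  open Schedule H H′ r D I
  open Consecutive con
  open OnlyLostPrime lost
  open MatchesInsertions matches

  H>0 : 0 < H
  H>0 = proj₁ source-hc
  H′>0 : 0 < H′
  H′>0 = proj₁ target-hc
  H≤H′ : H ≤ H′
  H≤H′ = <⇒≤ H<H′
  vrH>0 : 0 < v r H
  vrH>0 = ≤-reflexive (sym a≡1)

  x₀ N : ℕ
  x₀ = H ÷ r
  N  = d x₀

  x₀>0 : 0 < x₀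
  x₀>0 = proj₁ (v>0⇒÷ r-prime H>0 vrH>0)
  H≡ : H ≡ x₀ * r
  H≡ = proj₂ (v>0⇒÷ r-prime H>0 vrH>0)
  vx₀-r : v r x₀ ≡ 0
  vx₀-r = suc-injective (trans (v-÷-same r-prime H>0 vrH>0) a≡1)
  vx₀-other : ∀ {s} → Prime s → s ≢ r → v s x₀ ≡ v s H
  vx₀-other sr s≢r = v-÷-other r-prime sr s≢r H>0 vrH>0
  dH≡ : d H ≡ N * 2
  dH≡ = trans (cong d H≡) (d-*-new r-prime x₀>0 vx₀-r)

  good-x₀ : Good H′ N x₀
  good-x₀ = good x₀>0 (≤-trans (subst (x₀ ≤_) (sym H≡) (m≤m*n x₀ r {{prime⇒nonZero r-prime}})) H≤H′) ≤-refl
  good-H : Good H′ N H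
  good-H = good H>0 H≤H′ (subst (N ≤_) (sym dH≡) (m≤m*n N 2))

  -- As `r` has exponent one in `H`, the layer `⟨ r , 1 ⟩` is its only deletion layer. Dividing by
  -- `r` therefore removes exactly the layer that the listing leaves out.
  remaining : ListsDeletions x₀ H′ D
  remaining = record { complete = λ L → mk⇔ (to L) (from L) ; ordered = ListsRemainingDeletions.ordered lists }
    where
    to : ∀ L → (∃[ i ] D i ≡ L) → RequiredDeletion x₀ H′ L
    to L@(⟨ s , l ⟩) i∈ = sr , T<l , l≤x₀ (s ≟ r)
      where
      required′ : RequiredDeletion H H′ L × L ≢ ⟨ r , 1 ⟩
      required′ = Equivalence.to (ListsRemainingDeletions.complete lists L) i∈
      sr  = proj₁ (proj₁ required′)
      T<l = proj₁ (proj₂ (proj₁ required′))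
      l≤H = proj₂ (proj₂ (proj₁ required′))
      l≤x₀ : Dec (s ≡ r) → l ≤ v s x₀
      l≤x₀ (no s≢r)   = subst (l ≤_) (sym (vx₀-other sr s≢r)) l≤H
      l≤x₀ (yes refl) = contradiction (cong ⟨ r ,_⟩ (≤-antisym (subst (l ≤_) a≡1 l≤H) (≤-trans (s≤s z≤n) T<l))) (proj₂ required′)
    from : ∀ L → RequiredDeletion x₀ H′ L → ∃[ i ] D i ≡ L
    from L@(⟨ s , l ⟩) (sr , T<l , l≤x₀) = Equivalence.from (ListsRemainingDeletions.complete lists L)
      ((sr , T<l , subst (l ≤_) (vx₀-other sr s≢r) l≤x₀) , s≢r ∘ cong base)
      where
      s≢r : s ≢ r
      s≢r refl = contradiction (≤-trans (s≤s z≤n) (≤-trans T<l (subst (l ≤_) vx₀-r l≤x₀))) λ ()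

  module _ (e<j : ∀ i → e i < j i) (y≤H : ∀ i → y i ≤ H) (j≤A : ∀ i → j i ≤ A i) where

    matched : ∃[ w ] Run H′ (Good H′ N) x₀ matchedMoves w × (∀ {s} → Prime s → v s w ≤ v s H′)
    matched = matched-run x₀ D I good-x₀ remaining
      (λ i → proj₁ (required i) , proj₂ (proj₂ (required i))) e<j (λ i → ≤-trans (y≤H i) H≤H′) j≤A

    w : ℕ
    w = proj₁ matched

    w≤H′ : ∀ {s} → Prime s → v s w ≤ v s H′
    w≤H′ = proj₂ (proj₂ matched)

    run-to-w : Run H′ (Good H′ N) H (delete ⟨ r , 1 ⟩ ∷ matchedMoves) w
    run-to-w = step good-H (r-prime , a≡1 , s≤s (≤-reflexive b≡0)) (proj₁ (proj₂ matched))

    w>0 : 0 < w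
    w>0 = run⇒end>0 H>0 run-to-w

    full-run : ∀ R → Run H′ (0 <_) w (map insert R) H′ → Run H′ (Good H′ N) H (schedule R) H′
    full-run R s = run-++ run-to-w (insertions-good R (run⇒end run-to-w) ≤-refl s)

    admissible : ∀ R → Run H′ (Good H′ N) H (schedule R) H′ → AdmissibleGeodesic H H′ (vertices H (schedule R))
    admissible R s = record
      { starts = refl ; ends = run⇒last s ; positive = All.map good>0 (run⇒all s) ; steps = run⇒linked H>0 s }
      , All.map good≤T (run⇒all s)

    schedule-works : ∀ R → RemainingInsertions R → StackAdmissible R →
                     Executable H (schedule R) × AdmissibleGeodesic H H′ (vertices H (schedule R))
    schedule-works R R⇔ stack = run⇒executable H>0 s , admissible R s
      where
      -- `R` is described by absence from `matchedMoves`, while `missing-run` needs levels above the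
      -- exponents of `w`; `inserted⁺` and `inserted⁻` translate between the two.
      to : ∀ L → L ∈ R → RequiredInsertion w H′ L
      to L@(⟨ s , l ⟩) L∈R = sr , ≰⇒> w≱l , l≤T
        where
        required′ : RequiredInsertion H H′ L × insert L ∉ matchedMoves
        required′ = Equivalence.to (R⇔ L) L∈R
        sr  = proj₁ (proj₁ required′)
        H<l = proj₁ (proj₂ (proj₁ required′))
        l≤T = proj₂ (proj₂ (proj₁ required′))
        in-matched : ∀ {ms} → insert L ∈ delete ⟨ r , 1 ⟩ ∷ ms → insert L ∈ ms
        in-matched (there L∈) = L∈
        w≱l : ¬ l ≤ v s w
        w≱l l≤w = proj₂ required′ (in-matched (inserted⁺ sr H>0 run-to-w H<l l≤T l≤w))
      from : ∀ L → RequiredInsertion w H′ L → L ∈ R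
      from L@(⟨ s , l ⟩) (sr , w<l , l≤T) = Equivalence.from (R⇔ L)
        ( (sr , ≰⇒> (λ l≤H → <⇒≱ w<l (run-preserves-≤ sr H>0 run-to-w l≤T l≤H)) , l≤T)
        , λ L∈ → <⇒≱ w<l (inserted⁻ H>0 run-to-w (there L∈)))
      s : Run H′ (Good H′ N) H (schedule R) H′
      s = full-run R (missing-run R w>0 H′>0 w≤H′ (λ L → mk⇔ (to L) (from L)) stack)

    capacity : Isβgeo H H′ ½
    capacity = N
      , record
          { attained = vertices H (schedule R) , admissible R s , ≤-antisym (upper _ (admissible R s)) lower
          ; maximal  = upper
          }
      , half N (d H) {{d-nonZero H}} dH≡
      where
      -- Attainment needs an actual geodesic, so an order of the remaining insertions is constructed
      -- here.
      R = proj₁ (completion w>0 H′>0 w≤H′)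
      s : Run H′ (Good H′ N) H (schedule R) H′
      s = full-run R (proj₂ (completion w>0 H′>0 w≤H′))
      lower : N ≤ minDivisors (vertices H (schedule R))
      lower = ≤minDivisors _ _ (All.map good-d (run⇒all s))
      upper : ∀ γ → AdmissibleGeodesic H H′ γ → minDivisors γ ≤ N
      upper (z ∷ zs) (geo , ≤H′) =
        let u , u∈ , ur∈ , u>0 , vu≡0 = losing-edge H′ r-prime b≡0 z zs positive steps
              (subst (λ x → 0 < v r x) (sym starts) vrH>0) (trans (cong (v r) ends) b≡0)
            ur≢H′ : u * r ≢ H′
            ur≢H′ ur≡H′ = 1+n≢0 (trans (sym (v-*-same r-prime u>0)) (trans (cong (v r) ur≡H′) b≡0))
            du≤N : d u ≤ N
            -- Both `u * r` and `H` have an `r`-free half: the bound `d (u * r) ≤ d H` reads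
            -- `d u * 2 ≤ N * 2`.
            du≤N = *-cancelʳ-≤ (d u) N 2 (subst₂ _≤_ (d-*-new r-prime u>0 vu≡0) dH≡
              (d≤d-source con (*>0 u>0 (prime>0 r-prime)) (≤∧≢⇒< (All.lookup ≤H′ ur∈) ur≢H′)))
        in ≤-trans (minDivisors≤ z zs u∈) du≤N
        where open Geodesic geo

  level≤ : ∀ i → p i < q i → j i ≤ A i
  -- Antitonicity is applied to the target: `j i ≤ v (q i) H′ ≤ v (p i) H′ < A i`.
  level≤ i p<q = ≤-trans (proj₂ (proj₂ (required i)))
    (≤-trans (hc-exponents-antitone target-hc (proj₁ D-required) (proj₁ (required i)) p<q) (<⇒≤ (proj₁ (proj₂ D-required))))
    where
    D-required : RequiredDeletion H H′ (D i)
    D-required = proj₁ (Equivalence.to (ListsRemainingDeletions.complete lists (D i)) (i , refl))
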